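{- Let $G$ be a finite, undirected, simple, connected graph. Then $G\in\mathbf{m_3}/\mathbf{l_2}$ if and only if $G$ is hole-free. That is, $\mathbf{m_3}/\mathbf{l_2}=\text{hole-free}$.
   Context: All graphs are finite, undirected, simple and connected. A $uv$-walk is a sequence of (not necessarily distinct) vertices $W: u=v_0,v_1,\ldots,v_n=v$ with $v_{i-1}$ adjacent to $v_i$ for all $i\in\{1,\ldots,n\}$; $v_1,\ldots,v_{n-1}$ are its internal vertices and $n$ is its length. A $uv$-path is a $uv$-walk with distinct vertices. A $uv$-induced path is a $uv$-path in which two vertices are adjacent in $G$ if and only if they are consecutive on the path. For non-adjacent vertices $u,v$: - $\mathbf{m_3}(u,v)$ is the set of $uv$-$m_3$ paths, i.e. $uv$-induced paths of length at least three. - $\mathbf{l_2}(u,v)$ is the set of $uv$-$l_2$-paths, i.e. $uv$-induced paths of length at most $2$. Domination: for non-adjacent $u,v$, a $uv$-walk $W$ dominates a $uv$-walk $W'$ if every internal vertex of $W'$ is adjacent to some internal vertex of $W$ or belongs to $W$. The class $\mathbf{A}/\mathbf{B}$ consists of all graphs $G$ such that for every pair of non-adjacent vertices $u,v$ of $G$, every walk $W\in\mathbf{A}(u,v)$ dominates every walk $W'\in\mathbf{B}(u,v)$ (vacuously true if one of the sets is empty). A hole is a chordless cycle with at least five vertices; a graph is hole-free if it contains no hole as an induced subgraph. -}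

module Defs where

open import Level using (0ℓ)
open import Data.Nat using (ℕ; suc; _≤_; _<_)
open import Data.Fin using (Fin; zero; suc; toℕ; fromℕ; inject₁)
open import Data.Product using (Σ-syntax; ∃-syntax; _×_)
open import Data.Sum using (_⊎_)
open import Function.Bundles using (_⇔_)
open import Function.Definitions using (Injective)
open import Relation.Binary using (Rel; Symmetric; Irreflexive; Decidable)
open import Relation.Binary.PropositionalEquality using (_≡_)
open import Relation.Nullary using (¬_)
open import Relation.Unary using (Pred)

-- Adjacency in a finite graph is given data, hence decidable.
record Graph : Set₁ where
  infix 4 _~_
  field
    order    : ℕ
    _~_      : Rel (Fin order) 0ℓ
    ~-sym    : Symmetric _~_
    ~-irrefl : Irreflexive _≡_ _~_
    _~?_     : Decidable _~_

  Vertex : Set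
  Vertex = Fin order

open Graph public using (Vertex)

record Walk (G : Graph) (u v : Vertex G) : Set where
  open Graph G using (_~_)
  field
    length : ℕ
    at     : Fin (suc length) → Vertex G
    start  : at zero ≡ u
    end    : at (fromℕ length) ≡ v
    step   : ∀ (i : Fin length) → at (inject₁ i) ~ at (suc i)

Connected : Pred Graph 0ℓ
Connected G = ∀ (u v : Vertex G) → Walk G u v

Consecutive : ∀ {n} → Rel (Fin n) 0ℓ
Consecutive i j = toℕ j ≡ suc (toℕ i) ⊎ toℕ i ≡ suc (toℕ j)

module _ {G : Graph} {u v : Vertex G} where
  open Graph G using (_~_)
  open Walk

  _belongsTo_ : Vertex G → Walk G u v → Set
  x belongsTo W = ∃[ i ] at W i ≡ x

  _internalTo_ : Vertex G → Walk G u v → Set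
  x internalTo W = ∃[ i ] (0 < toℕ i × toℕ i < length W × at W i ≡ x)

  IsPath : Pred (Walk G u v) 0ℓ
  IsPath W = Injective _≡_ _≡_ (at W)

  IsInducedPath : Pred (Walk G u v) 0ℓ
  IsInducedPath W = IsPath W × (∀ i j → at W i ~ at W j ⇔ Consecutive i j)

  _dominates_ : Rel (Walk G u v) 0ℓ
  W dominates W′ = ∀ x → x internalTo W′ →
    (∃[ y ] (y internalTo W × x ~ y)) ⊎ x belongsTo W

WalkClass : Set₁
WalkClass = (G : Graph) (u v : Vertex G) → Pred (Walk G u v) 0ℓ

m₃ : WalkClass
m₃ G u v W = IsInducedPath W × 3 ≤ Walk.length W

l₂ : WalkClass
l₂ G u v W = IsInducedPath W × Walk.length W ≤ 2

-- The case u ≡ v is not excluded: no path of positive length is closed,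
-- so m₃ G u u is empty.
_/_ : WalkClass → WalkClass → Pred Graph 0ℓ
(A / B) G = ∀ (u v : Vertex G) → ¬ (u ~ v) →
  ∀ (W W′ : Walk G u v) → A G u v W → B G u v W′ → W dominates W′
  where open Graph G using (_~_)

CyclicSucc : ∀ {k} → Rel (Fin k) 0ℓ
CyclicSucc {k} i j = toℕ j ≡ suc (toℕ i) ⊎ (suc (toℕ i) ≡ k × toℕ j ≡ 0)

record Cycle (G : Graph) : Set where
  open Graph G using (_~_)
  field
    size     : ℕ
    3≤size   : 3 ≤ size
    at       : Fin size → Vertex G
    distinct : Injective _≡_ _≡_ at
    edge     : ∀ i j → CyclicSucc i j → at i ~ at j

-- Every edge of G between vertices of C is an edge of C; equivalently, C is
-- the subgraph of G induced by its vertices.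
Chordless : ∀ {G} → Pred (Cycle G) 0ℓ
Chordless {G} C = ∀ i j → at i ~ at j → CyclicSucc i j ⊎ CyclicSucc j i
  where
  open Graph G using (_~_)
  open Cycle C using (at)

IsHole : ∀ {G} → Pred (Cycle G) 0ℓ
IsHole C = Chordless C × 5 ≤ Cycle.size C

HoleFree : Pred Graph 0ℓ
HoleFree G = ¬ (Σ[ C ∈ Cycle G ] IsHole C)

{-# OPTIONS --safe #-}
-- A hole with one vertex x removed is an induced path of length at least three
-- between the two neighbours of x on the hole.  Conversely, a common neighbour x
-- of the ends of an induced path of length at least three closes that path up to
-- a hole precisely when the path does not dominate x.
module Submission where

open import Defs
open import Data.Empty using (⊥-elim)
open import Data.Fin using (Fin; zero; suc; toℕ; fromℕ; inject₁)
open import Data.Fin.Properties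
  using (any?; _≟_; toℕ-fromℕ; toℕ-inject₁; toℕ-injective; toℕ≤pred[n]; suc-injective)
open import Data.Nat using (suc; _+_; _≤_; z≤n; s≤s; _<?_)
open import Data.Nat.Properties using (≤-refl; ≤-trans; <-irrefl; ≤∧≢⇒<)
  renaming (suc-injective to suc-injectiveℕ; _≟_ to _≟ℕ_)
open import Data.Product using (_×_; _,_; ∃-syntax; proj₁; proj₂; uncurry)
open import Data.Sum using (_⊎_; inj₁; inj₂; swap)
open import Data.Vec.Functional using (_∷_; [])
open import Function.Base using (_∘_)
open import Function.Bundles using (_⇔_; mk⇔; Equivalence)
open import Relation.Binary.PropositionalEquality using (_≡_; _≢_; refl; sym; trans; cong; subst)
open import Relation.Nullary using (¬_; yes; no; _×-dec_)
open import Relation.Unary using (_∈_)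

module _ {G : Graph} where
  open Graph G using (_~_; ~-sym; ~-irrefl; _~?_)

  module _ {x y z : Vertex G} (x~y : x ~ y) (y~z : y ~ z) where

    cherry : Walk G x z
    cherry = record
      { length = 2
      ; at     = x ∷ y ∷ z ∷ []
      ; start  = refl
      ; end    = refl
      ; step   = λ { zero → x~y ; (suc zero) → y~z }
      }

    cherry-induced : x ≢ z → ¬ x ~ z → IsInducedPath cherry
    cherry-induced x≢z x≁z = injective _ _ , λ i j → mk⇔ (to i j) (from i j)
      where
      open Walk cherry using (at)

      injective : ∀ i j → at i ≡ at j → i ≡ j
      injective zero zero _ = refl
      injective zero (suc zero) e = ⊥-elim (~-irrefl e x~y)
      injective zero (suc (suc zero)) e = ⊥-elim (x≢z e)
      injective (suc zero) zero e = ⊥-elim (~-irrefl (sym e) x~y)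
      injective (suc zero) (suc zero) _ = refl
      injective (suc zero) (suc (suc zero)) e = ⊥-elim (~-irrefl e y~z)
      injective (suc (suc zero)) zero e = ⊥-elim (x≢z (sym e))
      injective (suc (suc zero)) (suc zero) e = ⊥-elim (~-irrefl (sym e) y~z)
      injective (suc (suc zero)) (suc (suc zero)) _ = refl

      to : ∀ i j → at i ~ at j → Consecutive i j
      to zero zero a = ⊥-elim (~-irrefl refl a)
      to zero (suc zero) _ = inj₁ refl
      to zero (suc (suc zero)) a = ⊥-elim (x≁z a)
      to (suc zero) zero _ = inj₂ refl
      to (suc zero) (suc zero) a = ⊥-elim (~-irrefl refl a)
      to (suc zero) (suc (suc zero)) _ = inj₁ refl
      to (suc (suc zero)) zero a = ⊥-elim (x≁z (~-sym a))
      to (suc (suc zero)) (suc zero) _ = inj₂ refl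
      to (suc (suc zero)) (suc (suc zero)) a = ⊥-elim (~-irrefl refl a)

      forward : ∀ i j → toℕ j ≡ suc (toℕ i) → at i ~ at j
      forward zero (suc zero) _ = x~y
      forward (suc zero) (suc (suc zero)) _ = y~z
      forward (suc (suc zero)) (suc (suc zero)) ()

      from : ∀ i j → Consecutive i j → at i ~ at j
      from i j (inj₁ e) = forward i j e
      from i j (inj₂ e) = ~-sym (forward j i e)

  -- An internal index lies strictly between `0` and a length of at most `2`, so the length is `2`
  -- and the index is `1`; the two steps of the walk are then the required edges.
  short-internal-adjacent : ∀ {u v x} (W : Walk G u v) → Walk.length W ≤ 2 →
    x internalTo W → u ~ x × x ~ v
  short-internal-adjacent record { length = 0 } _ (_ , _ , () , _)
  short-internal-adjacent record { length = 1 } _ (suc _ , _ , s≤s () , _)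
  short-internal-adjacent
    record { length = 2 ; start = refl ; end = refl ; step = step } _
    (suc zero , _ , _ , refl) = step zero , step (suc zero)
  short-internal-adjacent record { length = 2 } _ (suc (suc _) , _ , s≤s (s≤s ()) , _)
  short-internal-adjacent record { length = suc (suc (suc _)) } (s≤s (s≤s ())) _

  -- The apex is the hole vertex of index `0`, and the rim is the path through all the others. The
  -- apex is the only internal vertex of the cherry over it, so domination of the cherry by the rim
  -- is a claim about the apex alone.
  m₃/l₂⇒¬hole : G ∈ (m₃ / l₂) → (C : Cycle G) → ¬ IsHole C
  m₃/l₂⇒¬hole G∈m₃/l₂
    -- With size `n + 2` the rim has `n + 1` vertices and hence length `n`, so `5 ≤ size` unfolds to
    -- `3 ≤ n`.
    record { size = suc (suc n) ; at = at ; distinct = distinct ; edge = edge }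
    (chordless , s≤s (s≤s 3≤n)) =
    undominated (G∈m₃/l₂ _ _ ends-nonadjacent rim (cherry first~apex apex~last)
      (rim-induced , 3≤n)
      (cherry-induced first~apex apex~last ends-distinct ends-nonadjacent , ≤-refl)
      (at zero) (suc zero , s≤s z≤n , ≤-refl , refl))
    where
    first~apex : at (suc zero) ~ at zero
    first~apex = ~-sym (edge zero (suc zero) (inj₁ refl))

    apex~last : at zero ~ at (fromℕ (suc n))
    apex~last = ~-sym (edge (fromℕ (suc n)) zero (inj₂ (cong (2 +_) (toℕ-fromℕ n) , refl)))

    rim : Walk G (at (suc zero)) (at (fromℕ (suc n)))
    rim = record
      { length = n
      ; at     = at ∘ suc
      ; start  = refl
      ; end    = refl
      ; step   = λ i → edge (suc (inject₁ i)) (suc (suc i))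
                   (inj₁ (cong (2 +_) (sym (toℕ-inject₁ i))))
      }

    rim-to : ∀ i j → at (suc i) ~ at (suc j) → Consecutive i j
    rim-to i j a with chordless (suc i) (suc j) a
    ... | inj₁ (inj₁ e) = inj₁ (suc-injectiveℕ e)
    ... | inj₂ (inj₁ e) = inj₂ (suc-injectiveℕ e)

    rim-from : ∀ i j → Consecutive i j → at (suc i) ~ at (suc j)
    rim-from i j (inj₁ e) = edge (suc i) (suc j) (inj₁ (cong suc e))
    rim-from i j (inj₂ e) = ~-sym (edge (suc j) (suc i) (inj₁ (cong suc e)))

    rim-induced : IsInducedPath rim
    rim-induced = suc-injective ∘ distinct , λ i j → mk⇔ (rim-to i j) (rim-from i j)

    ends-distinct : at (suc zero) ≢ at (fromℕ (suc n))
    ends-distinct e =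
      <-irrefl (trans (suc-injectiveℕ (cong toℕ (distinct e))) (toℕ-fromℕ n))
        (≤-trans (s≤s z≤n) 3≤n)

    ends-nonadjacent : ¬ at (suc zero) ~ at (fromℕ (suc n))
    -- Adjacent ends would be consecutive on the rim, forcing `n ≡ 1`.
    ends-nonadjacent a with rim-to zero (fromℕ n) a
    ... | inj₁ e =
      <-irrefl (trans (sym e) (toℕ-fromℕ n)) (≤-trans (s≤s (s≤s z≤n)) 3≤n)

    -- By chordlessness the apex has only the rim indices `0` and `n` as neighbours, and neither is
    -- internal. Membership in the rim would contradict distinctness of the hole's vertices.
    undominated : ¬ ((∃[ y ] (y internalTo rim × at zero ~ y)) ⊎ at zero belongsTo rim)
    undominated (inj₁ (_ , (i , 0<i , i<n , refl) , a)) with chordless zero (suc i) a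
    ... | inj₁ (inj₁ e) = <-irrefl (sym (suc-injectiveℕ e)) 0<i
    ... | inj₂ (inj₂ (e , _)) = <-irrefl (suc-injectiveℕ (suc-injectiveℕ e)) i<n
    undominated (inj₂ (i , e)) with () ← distinct e

  -- The last two hypotheses deny the two ways in which `W` could dominate `x`.
  module _ {u v x : Vertex G} (W : Walk G u v) (W-induced : IsInducedPath W)
           (3≤length : 3 ≤ Walk.length W) (u~x : u ~ x) (x~v : x ~ v)
           (x∉W : ¬ x belongsTo W) (x≁internal : ¬ (∃[ y ] (y internalTo W × x ~ y))) where
    open Walk W

    closed-at : Fin (suc (suc length)) → Vertex G
    closed-at = x ∷ at

    closed-edge : ∀ i j → CyclicSucc i j → closed-at i ~ closed-at j
    closed-edge zero (suc zero) (inj₁ _) = subst (x ~_) (sym start) (~-sym u~x)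
    closed-edge (suc i) (suc j) (inj₁ e) =
      Equivalence.from (proj₂ W-induced i j) (inj₁ (suc-injectiveℕ e))
    -- This is the wrap-around edge: the last index of the cycle is the last index of `W`, shifted
    -- by one because `x` sits at `0`, so the edge is `v ~ x`.
    closed-edge (suc i) zero (inj₂ (e , _)) =
      subst (_~ x) (trans (sym end) (cong at (sym i≡last))) (~-sym x~v)
      where
      i≡last : i ≡ fromℕ length
      i≡last = toℕ-injective
        (trans (suc-injectiveℕ (suc-injectiveℕ e)) (sym (toℕ-fromℕ length)))

    closed-distinct : ∀ i j → closed-at i ≡ closed-at j → i ≡ j
    closed-distinct zero zero _ = refl
    closed-distinct zero (suc j) e = ⊥-elim (x∉W (j , sym e))
    closed-distinct (suc i) zero e = ⊥-elim (x∉W (i , e))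
    closed-distinct (suc i) (suc j) e = cong suc (proj₁ W-induced e)

    closed : Cycle G
    closed = record
      { size     = suc (suc length)
      ; 3≤size   = s≤s (s≤s (≤-trans (s≤s z≤n) 3≤length))
      ; at       = closed-at
      ; distinct = closed-distinct _ _
      ; edge     = closed-edge
      }

    -- Any index other than the first and the last is internal, where `x≁internal` forbids adjacency
    -- to `x`.
    apex-neighbour : ∀ i → x ~ at i → toℕ i ≡ 0 ⊎ toℕ i ≡ length
    apex-neighbour zero _ = inj₁ refl
    apex-neighbour (suc i) a with toℕ (suc i) ≟ℕ length
    ... | yes e = inj₂ e
    ... | no ≢last = ⊥-elim
      (x≁internal (_ , (suc i , s≤s z≤n , ≤∧≢⇒< (toℕ≤pred[n] (suc i)) ≢last , refl) , a))

    apex-consecutive : ∀ i → x ~ at i →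
      CyclicSucc zero (Fin.suc i) ⊎ CyclicSucc (Fin.suc i) zero
    apex-consecutive i a with apex-neighbour i a
    ... | inj₁ e = inj₁ (inj₁ (cong suc e))
    ... | inj₂ e = inj₂ (inj₂ (cong (2 +_) e , refl))

    closed-chordless : Chordless closed
    closed-chordless zero zero a = ⊥-elim (~-irrefl refl a)
    closed-chordless zero (suc j) a = apex-consecutive j a
    closed-chordless (suc i) zero a = swap (apex-consecutive i (~-sym a))
    closed-chordless (suc i) (suc j) a with Equivalence.to (proj₂ W-induced i j) a
    ... | inj₁ e = inj₁ (inj₁ (cong suc e))
    ... | inj₂ e = inj₂ (inj₁ (cong suc e))

    closed-hole : IsHole closed
    closed-hole = closed-chordless , s≤s (s≤s 3≤length)

  hole-free⇒m₃/l₂ : G ∈ HoleFree → G ∈ (m₃ / l₂)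
  hole-free⇒m₃/l₂ hole-free u v _ W W′ (W-induced , 3≤length) (_ , length≤2) x x∈W′
    -- Both forms of domination are decidable by search over the finitely many indices of `W`, so
    -- the negative hypothesis `hole-free` is needed only when both searches fail.
    with any? (λ i → at W i ≟ x)
       | any? (λ i → (0 <? toℕ i) ×-dec (toℕ i <? length W) ×-dec (x ~? at W i))
    where open Walk
  ... | yes x∈W | _ = inj₂ x∈W
  ... | no _ | yes (i , 0<i , i<n , a) = inj₁ (_ , (i , 0<i , i<n , refl) , a)
  ... | no x∉W | no undominated =
    let u~x , x~v = short-internal-adjacent W′ length≤2 x∈W′
        x≁internal = λ { (_ , (i , 0<i , i<n , refl) , a) → undominated (i , 0<i , i<n , a) }
    in ⊥-elim (hole-free
      ( closed W W-induced 3≤length u~x x~v x∉W x≁internal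
      , closed-hole W W-induced 3≤length u~x x~v x∉W x≁internal ))

theorem9 : ∀ (G : Graph) → Connected G → G ∈ (m₃ / l₂) ⇔ G ∈ HoleFree
theorem9 G _ = mk⇔ (uncurry ∘ m₃/l₂⇒¬hole) hole-free⇒m₃/l₂
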